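{- Let $K\subset L$ be commutative fields such that every element of $L$ that is algebraic over $K$ is separable over $K$. Let $A,B,C$ be finite-dimensional $K$-subspaces of $L$ with $A\neq\{0\}$, $B\neq\{0\}$ and $K\subset C$. Then either $\langle ABC\rangle=\langle AB\rangle$ or $\dim_K\langle ABC\rangle\geq\dim_KA+\dim_KB$.
   Context: For $S\subset L$, $\langle S\rangle$ denotes the $K$-subspace of $L$ spanned by $S$. Product sets: $AB=\{ab\mid a\in A,b\in B\}$, $ABC=\{abc\mid a\in A,b\in B,c\in C\}$. -}

module Defs where

open import Level using (Level; _⊔_; suc)
open import Algebra.Bundles using (CommutativeRing)
open import Data.Fin.Base using (Fin)
open import Data.List.Base using (List; []; _∷_; map)
open import Data.List.Relation.Unary.All using (All)
open import Data.Nat.Base as ℕ using (ℕ; zero)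
open import Data.Product.Base using (Σ-syntax; ∃-syntax; _×_)
open import Data.Vec.Functional using (Vector)
open import Relation.Nullary.Negation using (¬_)
open import Relation.Unary using (Pred; _∈_)
open import Relation.Binary.Definitions using (_Respects_)

-- The textbook notion of a commutative field.  The library's HeytingField
-- carries in addition an apartness relation, which classically is just _≉_.
record Field (c ℓ : Level) : Set (suc (c ⊔ ℓ)) where
  field
    commutativeRing : CommutativeRing c ℓ

  open CommutativeRing commutativeRing public

  field
    1≉0     : ¬ (1# ≈ 0#)
    inverse : ∀ x → ¬ (x ≈ 0#) → ∃[ y ] (x * y ≈ 1#)

module _ {c ℓ k : Level} (L : Field c ℓ) (K : Pred (Field.Carrier L) k) where

  open Field L

  -- Inverses are unique, so inverse-closed says that K is closed under
  -- inversion of nonzero elements.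
  record IsSubfield : Set (c ⊔ ℓ ⊔ k) where
    field
      respects-≈     : K Respects _≈_
      0∈             : 0# ∈ K
      1∈             : 1# ∈ K
      +-closed       : ∀ {x y} → x ∈ K → y ∈ K → x + y ∈ K
      *-closed       : ∀ {x y} → x ∈ K → y ∈ K → x * y ∈ K
      -‿closed       : ∀ {x} → x ∈ K → - x ∈ K
      inverse-closed : ∀ {x y} → x ∈ K → x * y ≈ 1# → y ∈ K

module LinearAlgebra {c ℓ k : Level} (L : Field c ℓ) (K : Pred (Field.Carrier L) k) where

  open Field L
  open import Algebra.Properties.CommutativeMonoid.Sum +-commutativeMonoid using (sum)

  record IsSubspace {a : Level} (A : Pred Carrier a) : Set (c ⊔ ℓ ⊔ k ⊔ a) where
    field
      respects-≈    : A Respects _≈_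
      0∈            : 0# ∈ A
      +-closed      : ∀ {x y} → x ∈ A → y ∈ A → x + y ∈ A
      scalar-closed : ∀ {r x} → r ∈ K → x ∈ A → r * x ∈ A

  ｛0｝ : Pred Carrier ℓ
  ｛0｝ x = x ≈ 0#

  lincomb : ∀ {n} → Vector Carrier n → Vector Carrier n → Carrier
  lincomb r v = sum (λ i → r i * v i)

  ⟨_⟩ : ∀ {s} → Pred Carrier s → Pred Carrier (c ⊔ ℓ ⊔ k ⊔ s)
  ⟨ S ⟩ x = ∃[ n ] Σ[ r ∈ Vector Carrier n ] Σ[ v ∈ Vector Carrier n ]
              ((∀ i → r i ∈ K) × (∀ i → v i ∈ S) × x ≈ lincomb r v)

  record FiniteDimensional {a : Level} (A : Pred Carrier a) : Set (c ⊔ ℓ ⊔ k ⊔ a) where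
    field
      dim         : ℕ
      basis       : Vector Carrier dim
      basis∈      : ∀ i → basis i ∈ A
      independent : ∀ (r : Vector Carrier dim) → (∀ i → r i ∈ K) →
                    lincomb r basis ≈ 0# → ∀ i → r i ≈ 0#
      spanning    : ∀ {x} → x ∈ A → Σ[ r ∈ Vector Carrier dim ]
                    ((∀ i → r i ∈ K) × x ≈ lincomb r basis)

  open FiniteDimensional public using (dim)

  infixl 7 _·_

  _·_ : ∀ {a b} → Pred Carrier a → Pred Carrier b → Pred Carrier (c ⊔ ℓ ⊔ a ⊔ b)
  (A · B) x = ∃[ a ] ∃[ b ] (a ∈ A × b ∈ B × x ≈ a * b)

-- A polynomial is its list of coefficients, constant term first; trailing
-- zeros are allowed, so polynomials are compared by _≈ₚ_.
module Polynomials {c ℓ : Level} (R : CommutativeRing c ℓ) where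

  open CommutativeRing R
  open import Algebra.Definitions.RawMonoid +-rawMonoid using () renaming (_×_ to _ℕ×_)

  Poly : Set c
  Poly = List Carrier

  coeff : Poly → ℕ → Carrier
  coeff []      _         = 0#
  coeff (a ∷ _) zero      = a
  coeff (_ ∷ p) (ℕ.suc i) = coeff p i

  infix  4 _≈ₚ_
  infixl 6 _+ₚ_
  infixl 7 _*ₚ_

  _≈ₚ_ : Poly → Poly → Set ℓ
  p ≈ₚ q = ∀ i → coeff p i ≈ coeff q i

  _+ₚ_ : Poly → Poly → Poly
  []      +ₚ q       = q
  (a ∷ p) +ₚ []      = a ∷ p
  (a ∷ p) +ₚ (b ∷ q) = (a + b) ∷ (p +ₚ q)

  _*ₚ_ : Poly → Poly → Poly
  []      *ₚ q = []
  (a ∷ p) *ₚ q = map (a *_) q +ₚ (0# ∷ (p *ₚ q))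

  eval : Poly → Carrier → Carrier
  eval []      x = 0#
  eval (a ∷ p) x = a + x * eval p x

  -- derivFrom n (a₀ ∷ a₁ ∷ …) = n a₀ ∷ (n + 1) a₁ ∷ …
  derivFrom : ℕ → Poly → Poly
  derivFrom n []      = []
  derivFrom n (a ∷ p) = (n ℕ× a) ∷ derivFrom (ℕ.suc n) p

  derivative : Poly → Poly
  derivative []      = []
  derivative (_ ∷ p) = derivFrom 1 p

  MonicOfDegree : ℕ → Poly → Set ℓ
  MonicOfDegree n p = coeff p n ≈ 1# × (∀ i → n ℕ.< i → coeff p i ≈ 0#)

module Separability {c ℓ k : Level} (L : Field c ℓ) (K : Pred (Field.Carrier L) k) where

  open Field L
  open Polynomials commutativeRing

  OverK : Poly → Set (c ⊔ k)
  OverK p = All K p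

  IsAlgebraic : Carrier → Set (c ⊔ ℓ ⊔ k)
  IsAlgebraic x = ∃[ p ] (OverK p × ¬ (p ≈ₚ []) × eval p x ≈ 0#)

  IsMinimalPolynomial : Poly → Carrier → Set (c ⊔ ℓ ⊔ k)
  IsMinimalPolynomial p x =
    OverK p × eval p x ≈ 0# ×
    ∃[ n ] (MonicOfDegree n p ×
      (∀ q m → OverK q → MonicOfDegree m q → eval q x ≈ 0# → n ℕ.≤ m))

  -- p is coprime to its derivative in K[X], i.e. it has no multiple root in
  -- any extension of K.
  IsSeparablePolynomial : Poly → Set (c ⊔ ℓ ⊔ k)
  IsSeparablePolynomial p =
    ∃[ u ] ∃[ v ] (OverK u × OverK v × u *ₚ p +ₚ v *ₚ derivative p ≈ₚ 1# ∷ [])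

  IsSeparable : Carrier → Set (c ⊔ ℓ ⊔ k)
  IsSeparable x = ∃[ p ] (IsMinimalPolynomial p x × IsSeparablePolynomial p)

{-# OPTIONS --safe #-}

-- Dyson's transform.  If 1 ∈ A and e ∈ B, then passing from (A , B) to
-- ({x ∈ A | x e ∈ B} , B + A e) preserves 1 ∈ A, preserves dim A + dim B and
-- keeps the product inside AB, while B grows.  Iterating until A B ⊆ B yields
-- subspaces H and V with H V ⊆ V, B ⊆ V ⊆ AB and
-- dim H + dim V = dim A + dim B.
-- Now let a b c ∉ ⟨AB⟩, and scale A so that a = 1.  Then y = b c ∉ V although
-- b ∈ V, and H y meets V only in 0: if h ≠ 0, then multiplication by h is an
-- injective, hence bijective, endomorphism of V.  So V ⊕ H y ⊆ ⟨ABC⟩ has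
-- dimension dim A + dim B.

module Submission where

open import Defs
open import Level using (Level; _⊔_; Lift; lift; lower)
open import Axiom.ExcludedMiddle using (ExcludedMiddle)
open import Data.Empty using (⊥-elim)
open import Data.Fin.Base using (zero; suc)
open import Data.Nat.Base using (ℕ; zero; suc; _+_; _≤_; _<_; _≥_; z≤n; s≤s)
import Data.Nat.Properties as ℕ
open import Data.Nat.Induction using (Acc; acc; <-wellFounded)
open import Data.Product.Base using (Σ-syntax; ∃-syntax; _×_; _,_; proj₁; proj₂)
open import Data.Sum.Base using (_⊎_; inj₁; inj₂)
open import Data.Vec.Functional using (Vector; _∷_; head; tail)
open import Function.Base using (_∘_; id)
open import Relation.Binary.PropositionalEquality as ≡ using (_≡_)
open import Relation.Nullary.Decidable.Core using (yes; no)
open import Relation.Nullary.Negation using (¬_; contradiction)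
open import Relation.Unary using (Pred; _⊆_; _≐_; _∈_; _∉_)

⊈⇒∃ : (∀ {p} → ExcludedMiddle p) → ∀ {a p q} {A : Set a} {P : Pred A p} {Q : Pred A q} →
      ¬ (P ⊆ Q) → ∃[ x ] (x ∈ P × x ∉ Q)
⊈⇒∃ em {P = P} {Q} P⊈Q with em {P = ∃[ x ] (x ∈ P × x ∉ Q)}
... | yes witness = witness
... | no ∄ = ⊥-elim (P⊈Q P⊆Q)
  where
  P⊆Q : P ⊆ Q
  P⊆Q {x} x∈P with em {P = x ∈ Q}
  ... | yes x∈Q = x∈Q
  ... | no  x∉Q = ⊥-elim (∄ (x , x∈P , x∉Q))

module Flags (em : ∀ {p} → ExcludedMiddle p) {c ℓ k : Level} (p : Level)
             (L : Field c ℓ) (K : Pred (Field.Carrier L) k) (K-subfield : IsSubfield L K) where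

  open Field L renaming (_+_ to _+ᴸ_) hiding (zero)
  open LinearAlgebra L K
  open IsSubspace
  open import Algebra.Properties.Ring ring using (-1*x≈-x)
  open import Algebra.Solver.Ring.NaturalCoefficients.Default commutativeSemiring
    using (solve; _:+_; _:*_; _:=_)
  open import Relation.Binary.Reasoning.Setoid setoid

  -- Subspaces and the sums W + A e and U + K v

  private
    variable
      s t u : Level
      e v w x y : Carrier
      m n : ℕ

  -- The spaces that occur as lower terms of a flag live at this common level.
  P : Level
  P = c ⊔ ℓ ⊔ k ⊔ p

  private
    variable
      U V W : Pred Carrier P
      A S T : Pred Carrier s

  -- Lifted to level `P` so that it can be the bottom of a flag.
  𝟎 : Pred Carrier P
  𝟎 x = Lift P (x ≈ 0#)

  infixl 6 _⊞_∙_ _⊕_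

  -- W + A e: the sign of z is immaterial when A is a subspace.
  _⊞_∙_ : Pred Carrier P → Pred Carrier s → Carrier → Pred Carrier (c ⊔ s ⊔ P)
  (W ⊞ A ∙ e) x = ∃[ z ] (z ∈ A × x +ᴸ z * e ∈ W)

  _⊕_ : Pred Carrier P → Carrier → Pred Carrier P
  U ⊕ v = U ⊞ K ∙ v

  K-subspace : IsSubspace K
  K-subspace = record
    { respects-≈ = F.respects-≈ ; 0∈ = F.0∈ ; +-closed = F.+-closed ; scalar-closed = F.*-closed }
    where module F = IsSubfield K-subfield

  1∈K : 1# ∈ K
  1∈K = IsSubfield.1∈ K-subfield

  𝟎-subspace : IsSubspace 𝟎
  𝟎-subspace = record
    { respects-≈    = λ x≈y (lift x≈0) → lift (trans (sym x≈y) x≈0)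
    ; 0∈            = lift refl
    ; +-closed      = λ (lift x≈0) (lift y≈0) → lift (trans (+-cong x≈0 y≈0) (+-identityˡ 0#))
    ; scalar-closed = λ _ (lift x≈0) → lift (trans (*-congˡ x≈0) (zeroʳ _))
    }

  -‿closed : IsSubspace A → x ∈ A → - x ∈ A
  -‿closed As x∈A =
    respects-≈ As (-1*x≈-x _) (scalar-closed As (IsSubfield.-‿closed K-subfield 1∈K) x∈A)

  +-cancelʳ-∈ : IsSubspace A → x +ᴸ y ∈ A → y ∈ A → x ∈ A
  +-cancelʳ-∈ {x = x} {y} As x+y∈A y∈A = respects-≈ As
    (begin
      x +ᴸ y +ᴸ - y     ≈⟨ +-assoc x y (- y) ⟩
      x +ᴸ (y +ᴸ - y)   ≈⟨ +-congˡ (-‿inverseʳ y) ⟩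
      x +ᴸ 0#           ≈⟨ +-identityʳ x ⟩
      x                 ∎)
    (+-closed As x+y∈A (-‿closed As y∈A))

  preimage-subspace : IsSubspace A → IsSubspace (λ x → x * e ∈ A)
  preimage-subspace {e = e} As = record
    { respects-≈    = λ x≈y → respects-≈ As (*-congʳ x≈y)
    ; 0∈            = respects-≈ As (sym (zeroˡ e)) (0∈ As)
    ; +-closed      = λ xe∈A ye∈A → respects-≈ As (sym (distribʳ e _ _)) (+-closed As xe∈A ye∈A)
    ; scalar-closed = λ r∈K xe∈A → respects-≈ As (sym (*-assoc _ _ e)) (scalar-closed As r∈K xe∈A)
    }

  𝟎⊆ : IsSubspace A → 𝟎 ⊆ A
  𝟎⊆ As (lift x≈0) = respects-≈ As (sym x≈0) (0∈ As)

  x*e+-x*e≈0 : ∀ x e → x * e +ᴸ - x * e ≈ 0#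
  x*e+-x*e≈0 x e = begin
    x * e +ᴸ - x * e    ≈⟨ distribʳ e x (- x) ⟨
    (x +ᴸ - x) * e      ≈⟨ *-congʳ (-‿inverseʳ x) ⟩
    0# * e              ≈⟨ zeroˡ e ⟩
    0#                  ∎

  ⊞-subspace : IsSubspace W → IsSubspace A → IsSubspace (W ⊞ A ∙ e)
  ⊞-subspace {e = e} Ws As = record
    { respects-≈ = λ x≈y (z , z∈A , q) → z , z∈A , respects-≈ Ws (+-congʳ x≈y) q
    ; 0∈ = 0# , 0∈ As , respects-≈ Ws (sym (trans (+-identityˡ _) (zeroˡ e))) (0∈ Ws)
    ; +-closed = λ {x} {y} (z , z∈A , q) (z′ , z′∈A , q′) → z +ᴸ z′ , +-closed As z∈A z′∈A ,
        respects-≈ Ws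
          (solve 5 (λ x y z z′ e → (x :+ z :* e) :+ (y :+ z′ :* e) := (x :+ y) :+ (z :+ z′) :* e)
             refl x y z z′ e)
          (+-closed Ws q q′)
    ; scalar-closed = λ {r} {x} r∈K (z , z∈A , q) → r * z , scalar-closed As r∈K z∈A ,
        respects-≈ Ws
          (solve 4 (λ r x z e → r :* (x :+ z :* e) := r :* x :+ (r :* z) :* e) refl r x z e)
          (scalar-closed Ws r∈K q)
    }

  ⊆⊞ : IsSubspace W → IsSubspace A → W ⊆ W ⊞ A ∙ e
  ⊆⊞ {e = e} Ws As x∈W =
    0# , 0∈ As , respects-≈ Ws (sym (trans (+-congˡ (zeroˡ e)) (+-identityʳ _))) x∈W

  ∈⊞ : IsSubspace W → IsSubspace A → x ∈ A → x * e ∈ W ⊞ A ∙ e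
  ∈⊞ {x = x} {e} Ws As x∈A =
    - x , -‿closed As x∈A , respects-≈ Ws (sym (x*e+-x*e≈0 x e)) (0∈ Ws)

  ⊞-least : IsSubspace T → W ⊆ T → (∀ {z} → z ∈ A → z * e ∈ T) → W ⊞ A ∙ e ⊆ T
  ⊞-least Ts W⊆T Ae⊆T (z , z∈A , q) = +-cancelʳ-∈ Ts (W⊆T q) (Ae⊆T z∈A)

  ⊕-subspace : IsSubspace U → IsSubspace (U ⊕ v)
  ⊕-subspace Us = ⊞-subspace Us K-subspace

  ⊆⊕ : IsSubspace U → U ⊆ U ⊕ v
  ⊆⊕ Us = ⊆⊞ Us K-subspace

  ∈⊕ : IsSubspace U → v ∈ U ⊕ v
  ∈⊕ Us = respects-≈ (⊕-subspace Us) (*-identityˡ _) (∈⊞ Us K-subspace 1∈K)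

  ⊕-least : IsSubspace T → U ⊆ T → v ∈ T → U ⊕ v ⊆ T
  ⊕-least Ts U⊆T v∈T = ⊞-least Ts U⊆T (λ r∈K → scalar-closed Ts r∈K v∈T)

  ⊞-monoˡ : V ⊆ W → V ⊞ A ∙ e ⊆ W ⊞ A ∙ e
  ⊞-monoˡ V⊆W (z , z∈A , q) = z , z∈A , V⊆W q

  ⊕-swap : IsSubspace U → U ⊕ v ⊕ w ⊆ U ⊕ w ⊕ v
  ⊕-swap {U} Us = ⊕-least (⊕-subspace (⊕-subspace Us)) (⊞-monoˡ {V = U} (⊆⊕ Us))
    (⊆⊕ (⊕-subspace Us) (∈⊕ Us))

  -- The coefficient of `w` in `v` modulo `U` is nonzero, since otherwise `v` would lie in `U`;
  -- dividing by it solves for `w`.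
  ⊕-exchange : IsSubspace U → v ∈ U ⊕ w → v ∉ U → w ∈ U ⊕ v
  ⊕-exchange {v = v} {w} Us (r , r∈K , v+rw∈U) v∉U with em {P = r ≈ 0#}
  ... | yes r≈0 = contradiction
          (respects-≈ Us (trans (+-congˡ (trans (*-congʳ r≈0) (zeroˡ w))) (+-identityʳ v)) v+rw∈U) v∉U
  ... | no  r≉0 with inverse r r≉0
  ...   | q , rq≈1 = q , q∈K , respects-≈ Us q[v+rw]≈w+qv (scalar-closed Us q∈K v+rw∈U)
    where
    q∈K = IsSubfield.inverse-closed K-subfield r∈K rq≈1
    q[v+rw]≈w+qv : q * (v +ᴸ r * w) ≈ w +ᴸ q * v
    q[v+rw]≈w+qv = begin
      q * (v +ᴸ r * w)       ≈⟨ solve 4 (λ q v r w → q :* (v :+ r :* w) := (r :* q) :* w :+ q :* v)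
                                  refl q v r w ⟩
      (r * q) * w +ᴸ q * v   ≈⟨ +-congʳ (trans (*-congʳ rq≈1) (*-identityˡ w)) ⟩
      w +ᴸ q * v             ∎

  -- Codimension by flags, and Steinitz exchange

  -- For U ⊆ S, Codim U S n says that S / U has dimension n.
  Codim : Pred Carrier P → Pred Carrier s → ℕ → Set (s ⊔ P)
  Codim U S zero    = S ⊆ U
  Codim U S (suc n) = ∃[ v ] (v ∈ S × v ∉ U × Codim (U ⊕ v) S n)

  -- The adjoined vectors need neither lie in `S` nor be new. This makes it a mere upper bound,
  -- which passes to smaller `S` and to larger `U`.
  Codim≤ : Pred Carrier P → Pred Carrier s → ℕ → Set (s ⊔ P)
  Codim≤ U S zero    = S ⊆ U
  Codim≤ U S (suc n) = ∃[ v ] Codim≤ (U ⊕ v) S n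

  codim⇒codim≤ : ∀ n → Codim U S n → Codim≤ U S n
  codim⇒codim≤ zero    S⊆U             = S⊆U
  codim⇒codim≤ (suc n) (v , _ , _ , h) = v , codim⇒codim≤ n h

  codim≤-resp : ∀ n → U ⊆ V → T ⊆ S → Codim≤ U S n → Codim≤ V T n
  codim≤-resp zero    U⊆V T⊆S S⊆U = U⊆V ∘ S⊆U ∘ T⊆S
  codim≤-resp {U = U} (suc n) U⊆V T⊆S (v , h) =
    v , codim≤-resp n (⊞-monoˡ {V = U} U⊆V) T⊆S h

  codim-resp : ∀ n → U ≐ V → Codim U S n → Codim V S n
  codim-resp zero    (U⊆V , _) S⊆U = U⊆V ∘ S⊆U
  codim-resp {U = U} {V} (suc n) (U⊆V , V⊆U) (v , v∈S , v∉U , h) =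
    v , v∈S , v∉U ∘ V⊆U , codim-resp n (⊞-monoˡ {V = U} U⊆V , ⊞-monoˡ {V = V} V⊆U) h

  codim≤-trans : ∀ m → Codim≤ U V m → Codim≤ V S n → Codim≤ U S (m + n)
  codim≤-trans {n = n} zero    V⊆U     h = codim≤-resp n V⊆U id h
  codim≤-trans         (suc m) (v , g) h = v , codim≤-trans m g h

  codim-trans : ∀ m → IsSubspace V → U ⊆ V → V ⊆ S → Codim U V m → Codim V S n → Codim U S (m + n)
  codim-trans {n = n} zero    Vs U⊆V V⊆S V⊆U h = codim-resp n (V⊆U , U⊆V) h
  codim-trans         (suc m) Vs U⊆V V⊆S (v , v∈V , v∉U , g) h =
    v , V⊆S v∈V , v∉U , codim-trans m Vs (⊕-least Vs U⊆V v∈V) V⊆S g h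

  -- Steinitz: adjoin the spanning vectors one by one until `v` falls into the space. The vector `w`
  -- adjoined at that moment can be traded for `v`, and `⊕-swap` carries `v` back past the earlier
  -- ones.
  codim≤-exchange : IsSubspace U → v ∈ S → v ∉ U → ∀ n → Codim≤ U S n →
                    ∃[ n′ ] (n ≡ suc n′ × Codim≤ (U ⊕ v) S n′)
  codim≤-exchange Us v∈S v∉U zero S⊆U = contradiction (S⊆U v∈S) v∉U
  codim≤-exchange {U = U} {v = v} Us v∈S v∉U (suc n) (w , h) with em {P = v ∈ U ⊕ w}
  ... | yes v∈U⊕w = n , ≡.refl ,
          codim≤-resp n (⊕-least (⊕-subspace Us) (⊆⊕ Us) (⊕-exchange Us v∈U⊕w v∉U)) id h
  ... | no  v∉U⊕w with codim≤-exchange (⊕-subspace Us) v∈S v∉U⊕w n h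
  ...   | n′ , ≡.refl , h′ = suc n′ , ≡.refl , w , codim≤-resp n′ (⊕-swap Us) id h′

  -- Each step of the strict flag uses up one of the `n` spanning vectors, by exchange.
  codim-bound : ∀ m → IsSubspace U → Codim U S m → Codim≤ U S n → m ≤ n
  codim-bound zero    Us _ _ = z≤n
  codim-bound {n = n} (suc m) Us (v , v∈S , v∉U , g) h with codim≤-exchange Us v∈S v∉U n h
  ... | n′ , ≡.refl , h′ = s≤s (codim-bound m (⊕-subspace Us) g h′)

  -- For `S = T`, used in both directions, this is the uniqueness of the codimension.
  codim-mono : IsSubspace U → S ⊆ T → Codim U S m → Codim U T n → m ≤ n
  codim-mono {m = m} {n = n} Us S⊆T g h =
    codim-bound m Us g (codim≤-resp n id S⊆T (codim⇒codim≤ n h))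

  -- Adjoin elements of `S` outside the current space as long as there are any; every choice lowers
  -- the upper bound by one, so the process stops.
  codim≤⇒codim : IsSubspace U → ∀ n → Codim≤ U S n → ∃[ m ] Codim U S m
  codim≤⇒codim Us zero S⊆U = zero , S⊆U
  codim≤⇒codim {U = U} {S = S} Us (suc n) h with em {P = S ⊆ U}
  ... | yes S⊆U = zero , S⊆U
  ... | no  S⊈U with ⊈⇒∃ em S⊈U
  ...   | v , v∈S , v∉U with codim≤-exchange Us v∈S v∉U (suc n) h
  ...     | _ , ≡.refl , h′ with codim≤⇒codim (⊕-subspace Us) n h′
  ...       | m , g = suc m , v , v∈S , v∉U , g

  -- Codimension under multiplication by an element

  *-⊕ : IsSubspace W → (∀ {x} → x ∈ U → x * e ∈ W) → x ∈ U ⊕ v → x * e ∈ W ⊕ v * e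
  *-⊕ {e = e} {x = x} {v} Ws Ue⊆W (r , r∈K , q) = r , r∈K , respects-≈ Ws
    (solve 4 (λ x r v e → (x :+ r :* v) :* e := x :* e :+ r :* (v :* e)) refl x r v e)
    (Ue⊆W q)

  codim≤-image : ∀ n → IsSubspace W → (∀ {x} → x ∈ U → x * e ∈ W) → T ⊆ W ⊞ A ∙ e →
                 Codim≤ U A n → Codim≤ W T n
  codim≤-image zero Ws Ue⊆W T⊆W+Ae A⊆U = ⊞-least Ws id (λ z∈A → Ue⊆W (A⊆U z∈A)) ∘ T⊆W+Ae
  codim≤-image {W = W} {U = U} {e = e} (suc n) Ws Ue⊆W T⊆W+Ae (v , h) =
    v * e , codim≤-image n (⊕-subspace Ws) (*-⊕ {U = U} Ws Ue⊆W)
              (⊞-monoˡ {V = W} (⊆⊕ Ws) ∘ T⊆W+Ae) h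

  private
    -- The target `T` is separate from `W ⊞ A ∙ e` because `W` grows along the recursion while the
    -- target has to stay fixed.
    codim-image′ : ∀ n → IsSubspace W → IsSubspace A →
                   (∀ {x} → x ∈ U → x * e ∈ W) → (∀ {x} → x ∈ A → x * e ∈ W → x ∈ U) →
                   (∀ {x} → x ∈ A → x * e ∈ T) → T ⊆ W ⊞ A ∙ e →
                   Codim U A n → Codim W T n
    codim-image′ zero Ws As Ue⊆W _ _ T⊆W+Ae A⊆U = ⊞-least Ws id (λ z∈A → Ue⊆W (A⊆U z∈A)) ∘ T⊆W+Ae
    codim-image′ {W = W} {U = U} {e = e} (suc n) Ws As Ue⊆W ker Ae⊆T T⊆W+Ae (v , v∈A , v∉U , h) =
      v * e , Ae⊆T v∈A , v∉U ∘ ker v∈A ,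
      codim-image′ n (⊕-subspace Ws) As (*-⊕ {U = U} Ws Ue⊆W)
        -- The kernel condition survives the enlargement: if `x * e` lies in `W ⊕ v * e`, then
        -- `(x + r v) e ∈ W` for some `r` in `K`, so `x + r v ∈ U`.
        (λ {x} x∈A (r , r∈K , q) → r , r∈K ,
          ker (+-closed As x∈A (scalar-closed As r∈K v∈A))
              (respects-≈ Ws
                (solve 4 (λ x r v e → x :* e :+ r :* (v :* e) := (x :+ r :* v) :* e) refl x r v e) q))
        Ae⊆T (⊞-monoˡ {V = W} (⊆⊕ Ws) ∘ T⊆W+Ae) h

  -- Multiplication by `e` maps `A` onto `W ⊞ A ∙ e` modulo `W`, and by the two hypotheses an
  -- element of `A` becomes zero there exactly when it lies in `U`.
  codim-image : IsSubspace W → IsSubspace A →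
                (∀ {x} → x ∈ U → x * e ∈ W) → (∀ {x} → x ∈ A → x * e ∈ W → x ∈ U) →
                Codim U A n → Codim W (W ⊞ A ∙ e) n
  codim-image {n = n} Ws As Ue⊆W ker = codim-image′ n Ws As Ue⊆W ker (∈⊞ Ws As) id

  *-cancelʳ-𝟎 : ¬ (e ≈ 0#) → x * e ∈ 𝟎 → x ∈ 𝟎
  *-cancelʳ-𝟎 {e} {x} e≉0 (lift xe≈0) with inverse e e≉0
  ... | e′ , ee′≈1 = lift (begin
    x              ≈⟨ *-identityʳ x ⟨
    x * 1#         ≈⟨ *-congˡ ee′≈1 ⟨
    x * (e * e′)   ≈⟨ *-assoc x e e′ ⟨
    x * e * e′     ≈⟨ *-congʳ xe≈0 ⟩
    0# * e′        ≈⟨ zeroˡ e′ ⟩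
    0#             ∎)

  𝟎-*ʳ : IsSubspace W → x ∈ 𝟎 → x * e ∈ W
  𝟎-*ʳ {e = e} Ws (lift x≈0) = 𝟎⊆ Ws (lift (trans (*-congʳ x≈0) (zeroˡ e)))

  codim-scale : IsSubspace A → ¬ (e ≈ 0#) → Codim 𝟎 A n → Codim 𝟎 (𝟎 ⊞ A ∙ e) n
  codim-scale As e≉0 =
    codim-image 𝟎-subspace As (𝟎-*ʳ 𝟎-subspace) (λ _ → *-cancelʳ-𝟎 e≉0)

  -- If `y ∉ V`, then `V ⊕ y` has dimension `n + 1`, yet multiplication by `e` embeds it into `V`.
  divides-stable : IsSubspace V → Codim 𝟎 V n → ¬ (e ≈ 0#) →
                   (∀ {x} → x ∈ V → x * e ∈ V) → y * e ∈ V → y ∈ V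
  divides-stable {V = V} {n = n} {e = e} {y = y} Vs dimV e≉0 Ve⊆V ye∈V with em {P = y ∈ V}
  ... | yes y∈V = y∈V
  ... | no  y∉V = ⊥-elim (ℕ.m+1+n≰m n
          (codim-mono 𝟎-subspace image⊆V (codim-scale V⊕y-subspace e≉0 dimV⊕y) dimV))
    where
    V⊕y-subspace = ⊕-subspace {v = y} Vs
    dimV⊕y : Codim 𝟎 (V ⊕ y) (n + 1)
    dimV⊕y = codim-trans {n = 1} n Vs (𝟎⊆ Vs) (⊆⊕ Vs) dimV (y , ∈⊕ Vs , y∉V , id)
    image⊆V : 𝟎 ⊞ V ⊕ y ∙ e ⊆ V
    image⊆V = ⊞-least {W = 𝟎} Vs (𝟎⊆ Vs) λ {z} z∈V⊕y →
      ⊕-least {T = V} Vs id ye∈V (*-⊕ {U = V} {x = z} {v = y} Vs Ve⊆V z∈V⊕y)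

  -- Dyson's transform

  -- The limit (A∞ , B∞) of Dyson transforms of a pair (A , B) with
  -- dim A + dim B = d and A B ⊆ M.
  record DysonLimit (B : Pred Carrier P) (M : Pred Carrier s) (d : ℕ) : Set (s ⊔ Level.suc P) where
    field
      A∞ B∞        : Pred Carrier P
      A∞-subspace  : IsSubspace A∞
      B∞-subspace  : IsSubspace B∞
      dimA∞ dimB∞  : ℕ
      A∞-codim     : Codim 𝟎 A∞ dimA∞
      B∞-codim     : Codim 𝟎 B∞ dimB∞
      dim-sum      : dimA∞ + dimB∞ ≡ d
      A∞*B∞⊆B∞     : ∀ {x y} → x ∈ A∞ → y ∈ B∞ → x * y ∈ B∞
      B⊆B∞         : B ⊆ B∞
      B∞⊆M         : B∞ ⊆ M

  private
    -- Induction on dim A. If `A e ⊆ B` for all `e` in `B`, the pair is already its own limit.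
    -- Otherwise some `x₀ * e` escapes from `B`, and the transform at `e` removes `x₀` from `A`, so
    -- that the dimension drops.
    dyson : Acc _<_ m → (A B : Pred Carrier P) {M : Pred Carrier s} →
            IsSubspace A → IsSubspace B → IsSubspace M → 1# ∈ A →
            (∀ {x y} → x ∈ A → y ∈ B → x * y ∈ M) →
            Codim 𝟎 A m → Codim 𝟎 B n → DysonLimit B M (m + n)
    dyson {m = m} {n = n} (acc rec) A B {M} As Bs Ms 1∈A AB⊆M dimA dimB
      with em {P = ∃[ e ] (e ∈ B × ∃[ x ] (x ∈ A × x * e ∉ B))}
    ... | no ∄ = record
      { A∞ = A ; B∞ = B ; A∞-subspace = As ; B∞-subspace = Bs
      ; A∞-codim = dimA ; B∞-codim = dimB ; dim-sum = ≡.refl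
      ; A∞*B∞⊆B∞ = A*B⊆B ; B⊆B∞ = id
      ; B∞⊆M = λ {x} x∈B → respects-≈ Ms (*-identityˡ x) (AB⊆M 1∈A x∈B)
      }
      where
      A*B⊆B : ∀ {x y} → x ∈ A → y ∈ B → x * y ∈ B
      A*B⊆B {x} {y} x∈A y∈B with em {P = x * y ∈ B}
      ... | yes xy∈B = xy∈B
      ... | no  xy∉B = ⊥-elim (∄ (y , y∈B , x , x∈A , xy∉B))
    ... | yes (e , e∈B , x₀ , x₀∈A , x₀e∉B) = record
      { DysonLimit limit
      ; dim-sum = ≡.trans (DysonLimit.dim-sum limit) sum-preserved
      ; B⊆B∞ = DysonLimit.B⊆B∞ limit ∘ ⊆⊞ Bs As
      }
      where
      A′ B′ : Pred Carrier P
      A′ x = x ∈ A × x * e ∈ B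
      B′ = B ⊞ A ∙ e

      A′s : IsSubspace A′
      A′s = record
        { respects-≈    = λ x≈y (x∈A , xe∈B) → respects-≈ As x≈y x∈A , E.respects-≈ x≈y xe∈B
        ; 0∈            = 0∈ As , E.0∈
        ; +-closed      = λ (x∈A , xe∈B) (y∈A , ye∈B) → +-closed As x∈A y∈A , E.+-closed xe∈B ye∈B
        ; scalar-closed = λ r∈K (x∈A , xe∈B) → scalar-closed As r∈K x∈A , E.scalar-closed r∈K xe∈B
        }
        where module E = IsSubspace (preimage-subspace {e = e} Bs)

      -- A flag of `A` bounds both A′ over 0 and `A` over A′; hence both have a codimension, and the
      -- two add up to `m`.
      Σp = codim≤⇒codim 𝟎-subspace m (codim≤-resp m id proj₁ (codim⇒codim≤ m dimA))
      p′ = proj₁ Σp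
      dimA′ : Codim 𝟎 A′ p′
      dimA′ = proj₂ Σp

      Σq = codim≤⇒codim A′s m (codim≤-resp m (𝟎⊆ A′s) id (codim⇒codim≤ m dimA))
      q′ = proj₁ Σq
      codimA′ : Codim A′ A q′
      codimA′ = proj₂ Σq

      dimA-split : Codim 𝟎 A (p′ + q′)
      dimA-split = codim-trans p′ A′s (𝟎⊆ A′s) proj₁ dimA′ codimA′

      m≡p′+q′ : m ≡ p′ + q′
      m≡p′+q′ = ℕ.≤-antisym (codim-mono 𝟎-subspace id dimA dimA-split)
                            (codim-mono 𝟎-subspace id dimA-split dimA)

      q′>0 : 0 < q′
      q′>0 with q′ | codimA′
      ... | zero  | A⊆A′ = contradiction (proj₂ (A⊆A′ x₀∈A)) x₀e∉B
      ... | suc _ | _    = s≤s z≤n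

      -- Multiplication by `e` identifies A/A′ with B′/B, so `B` gains exactly what `A` loses.
      dimB′ : Codim 𝟎 B′ (n + q′)
      dimB′ = codim-trans n Bs (𝟎⊆ Bs) (⊆⊞ Bs As) dimB
                (codim-image Bs As proj₂ (λ x∈A xe∈B → x∈A , xe∈B) codimA′)

      -- By commutativity x(y + z e) = x y + z(x e). The left side lies in `M` because
      -- `y + z e ∈ B`, the last term because `x e ∈ B`; subtract.
      A′B′⊆M : ∀ {x y} → x ∈ A′ → y ∈ B′ → x * y ∈ M
      A′B′⊆M {x} {y} (x∈A , xe∈B) (z , z∈A , q) = +-cancelʳ-∈ Ms
        (respects-≈ Ms (solve 4 (λ x y z e → x :* (y :+ z :* e) := x :* y :+ z :* (x :* e)) refl x y z e)
                       (AB⊆M x∈A q))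
        (AB⊆M z∈A xe∈B)

      limit : DysonLimit B′ M (p′ + (n + q′))
      limit = dyson (rec (≡.subst (p′ <_) (≡.sym m≡p′+q′) (ℕ.m<m+n p′ q′>0))) A′ B′ A′s
        (⊞-subspace Bs As) Ms (1∈A , respects-≈ Bs (sym (*-identityˡ e)) e∈B) A′B′⊆M dimA′ dimB′

      sum-preserved : p′ + (n + q′) ≡ m + n
      sum-preserved = ≡.trans (≡.cong (p′ +_) (ℕ.+-comm n q′))
        (≡.trans (≡.sym (ℕ.+-assoc p′ q′ n)) (≡.cong (_+ n) (≡.sym m≡p′+q′)))

  dysonLimit : (A B : Pred Carrier P) {M : Pred Carrier s} →
               IsSubspace A → IsSubspace B → IsSubspace M → 1# ∈ A →
               (∀ {x y} → x ∈ A → y ∈ B → x * y ∈ M) →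
               Codim 𝟎 A m → Codim 𝟎 B n → DysonLimit B M (m + n)
  dysonLimit = dyson (<-wellFounded _)

  -- Linear combinations and bases

  lincomb-∈ : IsSubspace A → (r v : Vector Carrier n) →
              (∀ i → r i ∈ K) → (∀ i → v i ∈ A) → lincomb r v ∈ A
  lincomb-∈ {n = zero}  As r v r∈K v∈A = 0∈ As
  lincomb-∈ {n = suc n} As r v r∈K v∈A =
    +-closed As (scalar-closed As (r∈K zero) (v∈A zero))
                (lincomb-∈ As (tail r) (tail v) (r∈K ∘ suc) (v∈A ∘ suc))

  lincomb-zero : (r v : Vector Carrier n) → (∀ i → r i ≈ 0#) → lincomb r v ≈ 0#
  lincomb-zero {n = zero}  r v r≈0 = refl
  lincomb-zero {n = suc n} r v r≈0 =
    trans (+-cong (trans (*-congʳ (r≈0 zero)) (zeroˡ _)) (lincomb-zero (tail r) (tail v) (r≈0 ∘ suc)))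
          (+-identityˡ 0#)

  ∷-∈ : (A : Pred Carrier s) {r : Carrier} {rs : Vector Carrier n} →
        r ∈ A → (∀ i → rs i ∈ A) → ∀ i → (r ∷ rs) i ∈ A
  ∷-∈ A r∈A rs∈A zero    = r∈A
  ∷-∈ A r∈A rs∈A (suc i) = rs∈A i

  ⟨⟩-least : (S : Pred Carrier s) → IsSubspace T → S ⊆ T → ⟨ S ⟩ ⊆ T
  ⟨⟩-least S Ts S⊆T (n , r , v , r∈K , v∈S , x≈) =
    respects-≈ Ts (sym x≈) (lincomb-∈ Ts r v r∈K (λ i → S⊆T (v∈S i)))

  ⟨⟩-cons : (S : Pred Carrier s) → x ∈ K → v ∈ S → y ∈ ⟨ S ⟩ → x * v +ᴸ y ∈ ⟨ S ⟩
  ⟨⟩-cons {x = x} {v = v} S x∈K v∈S (n , r , w , r∈K , w∈S , y≈) =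
    suc n , x ∷ r , v ∷ w , ∷-∈ K x∈K r∈K , ∷-∈ S v∈S w∈S , +-congˡ y≈

  ⟨⟩-respects : (S : Pred Carrier s) → x ≈ y → x ∈ ⟨ S ⟩ → y ∈ ⟨ S ⟩
  ⟨⟩-respects S x≈y (n , r , v , r∈K , v∈S , x≈) = n , r , v , r∈K , v∈S , trans (sym x≈y) x≈

  0∈⟨⟩ : (S : Pred Carrier s) → 0# ∈ ⟨ S ⟩
  0∈⟨⟩ S = 0 , (λ ()) , (λ ()) , (λ ()) , (λ ()) , refl

  ⟨⟩-subspace : (S : Pred Carrier s) → IsSubspace ⟨ S ⟩
  ⟨⟩-subspace S = record
    { respects-≈ = ⟨⟩-respects S
    ; 0∈ = 0∈⟨⟩ S
    ; +-closed = λ (n , r , v , r∈K , v∈S , x≈) y∈ →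
        ⟨⟩-respects S (+-congʳ (sym x≈)) (plus n r v r∈K v∈S y∈)
    ; scalar-closed = λ q∈K (n , r , v , r∈K , v∈S , x≈) →
        ⟨⟩-respects S (*-congˡ (sym x≈)) (scale q∈K n r v r∈K v∈S)
    }
    where
    plus : ∀ {y} n (r v : Vector Carrier n) → (∀ i → r i ∈ K) → (∀ i → v i ∈ S) →
           y ∈ ⟨ S ⟩ → lincomb r v +ᴸ y ∈ ⟨ S ⟩
    plus zero    r v r∈K v∈S y∈ = ⟨⟩-respects S (sym (+-identityˡ _)) y∈
    plus (suc n) r v r∈K v∈S y∈ = ⟨⟩-respects S (sym (+-assoc _ _ _))
      (⟨⟩-cons S (r∈K zero) (v∈S zero) (plus n (tail r) (tail v) (r∈K ∘ suc) (v∈S ∘ suc) y∈))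

    scale : ∀ {q} → q ∈ K → ∀ n (r v : Vector Carrier n) → (∀ i → r i ∈ K) → (∀ i → v i ∈ S) →
            q * lincomb r v ∈ ⟨ S ⟩
    scale q∈K zero    r v r∈K v∈S = ⟨⟩-respects S (sym (zeroʳ _)) (0∈⟨⟩ S)
    scale {q} q∈K (suc n) r v r∈K v∈S = ⟨⟩-respects S
      (trans (+-congʳ (*-assoc q _ _)) (sym (distribˡ q _ _)))
      (⟨⟩-cons S (scalar-closed K-subspace q∈K (r∈K zero)) (v∈S zero)
        (scale q∈K n (tail r) (tail v) (r∈K ∘ suc) (v∈S ∘ suc)))

  ⊆⟨⟩ : (S : Pred Carrier s) → S ⊆ ⟨ S ⟩
  ⊆⟨⟩ S {x} x∈S = ⟨⟩-respects S (trans (+-identityʳ _) (*-identityˡ x)) (⟨⟩-cons S 1∈K x∈S (0∈⟨⟩ S))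

  -- For fixed `y`, the elements that `y` multiplies into `⟨ S · T ⟩` form a subspace containing
  -- `S`.
  ⟨⟩·⊆⟨·⟩ : (S : Pred Carrier s) (T : Pred Carrier t) → x ∈ ⟨ S ⟩ → y ∈ T → x * y ∈ ⟨ S · T ⟩
  ⟨⟩·⊆⟨·⟩ {y = y} S T x∈⟨S⟩ y∈T =
    ⟨⟩-least S (preimage-subspace (⟨⟩-subspace (S · T)))
      (λ x∈S → ⊆⟨⟩ (S · T) (_ , y , x∈S , y∈T , refl)) x∈⟨S⟩

  -- Working modulo `U` makes the passage between bases and flags an induction: the head of the
  -- family is absorbed into `U`.
  IndependentMod : Pred Carrier P → Vector Carrier n → Set (c ⊔ ℓ ⊔ k ⊔ P)
  IndependentMod U v = ∀ r → (∀ i → r i ∈ K) → lincomb r v ∈ U → ∀ i → r i ≈ 0#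

  -- The combination is added to `x`, not subtracted, to agree with the form of `_⊞_∙_`.
  SpansMod : Pred Carrier P → Pred Carrier s → Vector Carrier n → Set (c ⊔ s ⊔ P)
  SpansMod U S v = ∀ {x} → x ∈ S → ∃[ r ] ((∀ i → r i ∈ K) × x +ᴸ lincomb r v ∈ U)

  basis⇒codim : ∀ n → IsSubspace U → (v : Vector Carrier n) → (∀ i → v i ∈ S) →
                IndependentMod U v → SpansMod U S v → Codim U S n
  basis⇒codim zero Us v v∈S indep spans x∈S =
    respects-≈ Us (+-identityʳ _) (proj₂ (proj₂ (spans x∈S)))
  basis⇒codim {U = U} (suc n) Us v v∈S indep spans =
    head v , v∈S zero , v₀∉U ,
    basis⇒codim n (⊕-subspace Us) (tail v) (v∈S ∘ suc)
      (λ r r∈K (q , q∈K , h) i →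
        indep (q ∷ r) (∷-∈ K q∈K r∈K) (respects-≈ Us (+-comm _ _) h) (suc i))
      (λ x∈S → let r , r∈K , h = spans x∈S in
        tail r , r∈K ∘ suc , head r , r∈K zero ,
        respects-≈ Us (trans (+-congˡ (+-comm _ _)) (sym (+-assoc _ _ _))) h)
    where
    v₀∉U : head v ∉ U
    v₀∉U v₀∈U = 1≉0 (indep (1# ∷ λ _ → 0#) (∷-∈ K 1∈K (λ _ → 0∈ K-subspace))
      (respects-≈ Us
        (sym (trans (+-cong (*-identityˡ _) (lincomb-zero _ (tail v) (λ _ → refl))) (+-identityʳ _)))
        v₀∈U)
      zero)

  codim⇒basis : ∀ n → IsSubspace U → Codim U S n →
                Σ[ v ∈ Vector Carrier n ] ((∀ i → v i ∈ S) × IndependentMod U v × SpansMod U S v)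
  codim⇒basis zero Us S⊆U = (λ ()) , (λ ()) , (λ _ _ _ ()) ,
    λ x∈S → (λ ()) , (λ ()) , respects-≈ Us (sym (+-identityʳ _)) (S⊆U x∈S)
  codim⇒basis {U = U} {S = S} (suc n) Us (v₀ , v₀∈S , v₀∉U , h) with codim⇒basis n (⊕-subspace Us) h
  ... | v , v∈S , indep , spans = v₀ ∷ v , ∷-∈ S v₀∈S v∈S , indep′ , λ x∈S →
      let r , r∈K , q , q∈K , g = spans x∈S in
      q ∷ r , ∷-∈ K q∈K r∈K , respects-≈ Us (trans (+-assoc _ _ _) (+-congˡ (+-comm _ _))) g
    where
    indep′ : IndependentMod U (v₀ ∷ v)
    indep′ r r∈K rv∈U = λ where
        zero    → r₀≈0
        (suc i) → r′≈0 i
      where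
      -- Independence modulo `U ⊕ v₀` kills the tail coefficients first. What remains is
      -- `head r * v₀ ∈ U`, and dividing by a nonzero `head r` would put `v₀` into `U`.
      r′≈0 : ∀ i → tail r i ≈ 0#
      r′≈0 = indep (tail r) (r∈K ∘ suc) (head r , r∈K zero , respects-≈ Us (+-comm _ _) rv∈U)
      r₀v₀∈U : head r * v₀ ∈ U
      r₀v₀∈U = respects-≈ Us
        (trans (+-congˡ (lincomb-zero (tail r) v r′≈0)) (+-identityʳ _)) rv∈U
      r₀≈0 : head r ≈ 0#
      r₀≈0 with em {P = head r ≈ 0#}
      ... | yes p = p
      ... | no r₀≉0 with inverse (head r) r₀≉0
      ...   | q , r₀q≈1 = contradiction (respects-≈ Us
                (trans (sym (*-assoc _ _ _))
                  (trans (*-congʳ (trans (*-comm _ _) r₀q≈1)) (*-identityˡ v₀)))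
                (scalar-closed Us (IsSubfield.inverse-closed K-subfield (r∈K zero) r₀q≈1) r₀v₀∈U))
                v₀∉U

  finiteDimensional⇒codim : IsSubspace A → (fin : FiniteDimensional A) → Codim 𝟎 A (dim fin)
  finiteDimensional⇒codim As fin =
    basis⇒codim (dim fin) 𝟎-subspace F.basis F.basis∈
      (λ r r∈K rv∈𝟎 → F.independent r r∈K (lower rv∈𝟎))
      -- Expand `- x`, since `SpansMod` asks for a combination that cancels `x`.
      (λ {x} x∈A → let r , r∈K , -x≈ = F.spanning (-‿closed As x∈A) in
        r , r∈K , lift (trans (+-congˡ (sym -x≈)) (-‿inverseʳ x)))
    where module F = FiniteDimensional fin

  codim⇒finiteDimensional : IsSubspace A → Codim 𝟎 A n → Σ[ fin ∈ FiniteDimensional A ] dim fin ≡ n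
  codim⇒finiteDimensional {n = n} As h with codim⇒basis n 𝟎-subspace h
  ... | v , v∈A , indep , spans = record
      { dim = n ; basis = v ; basis∈ = v∈A
      ; independent = λ r r∈K rv≈0 → indep r r∈K (lift rv≈0)
      ; spanning = λ {x} x∈A → let r , r∈K , h = spans (-‿closed As x∈A) in
          r , r∈K , (begin
            x                              ≈⟨ +-identityʳ x ⟨
            x +ᴸ 0#                        ≈⟨ +-congˡ (lower h) ⟨
            x +ᴸ (- x +ᴸ lincomb r v)      ≈⟨ +-assoc x (- x) _ ⟨
            x +ᴸ - x +ᴸ lincomb r v        ≈⟨ +-congʳ (-‿inverseʳ x) ⟩
            0# +ᴸ lincomb r v              ≈⟨ +-identityˡ _ ⟩
            lincomb r v                    ∎)
      } , ≡.refl

  -- Products and rescaled copies of subspaces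

  -- Each vector `v` spanning `A` over `U` contributes `B v`, which costs at most `n` further
  -- dimensions. `B` sits at level `P` so that `W ⊞ B ∙ v` can again serve as the bottom of a flag.
  ·-codim≤ : {A : Pred Carrier s} {B : Pred Carrier P} → ∀ m → IsSubspace W → IsSubspace B →
             (∀ {x y} → x ∈ U → y ∈ B → x * y ∈ W) →
             Codim≤ U A m → Codim≤ 𝟎 B n → ∃[ N ] Codim≤ W ⟨ A · B ⟩ N
  ·-codim≤ {A = A} {B = B} zero Ws Bs UB⊆W A⊆U dimB = zero ,
    ⟨⟩-least (A · B) Ws (λ (x , y , x∈A , y∈B , z≈) → respects-≈ Ws (sym z≈) (UB⊆W (A⊆U x∈A) y∈B))
  ·-codim≤ {W = W} {U = U} {n = n} {B = B} (suc m) Ws Bs UB⊆W (v , h) dimB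
    with ·-codim≤ {W = W ⊞ B ∙ v} m (⊞-subspace Ws Bs) Bs U⊕v*B⊆W⊞B∙v h dimB
    where
    U⊕v*B⊆W⊞B∙v : ∀ {x y} → x ∈ U ⊕ v → y ∈ B → x * y ∈ W ⊞ B ∙ v
    U⊕v*B⊆W⊞B∙v {x} {y} (r , r∈K , q) y∈B = r * y , scalar-closed Bs r∈K y∈B ,
      respects-≈ Ws (solve 4 (λ x y r v → (x :+ r :* v) :* y := x :* y :+ (r :* y) :* v) refl x y r v)
        (UB⊆W q y∈B)
  ... | N , g = n + N ,
        codim≤-trans {V = W ⊞ B ∙ v} n (codim≤-image n Ws (𝟎-*ʳ Ws) id dimB) g

  -- With `y` inverse to `x`, the space `𝟎 ⊞ A ∙ y` is `A y`, and membership in it is tested by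
  -- multiplying by `x`. For `x = y = 1` it is a copy of `A` that can be raised to level `P`.
  ∈-scale⁺ : IsSubspace A → x * y ≈ 1# → v * x ∈ A → v ∈ 𝟎 ⊞ A ∙ y
  ∈-scale⁺ {x = x} {y} {v} As xy≈1 vx∈A = respects-≈ (⊞-subspace 𝟎-subspace As)
    (trans (*-assoc v x y) (trans (*-congˡ xy≈1) (*-identityʳ v))) (∈⊞ 𝟎-subspace As vx∈A)

  ∈-scale⁻ : IsSubspace A → x * y ≈ 1# → v ∈ 𝟎 ⊞ A ∙ y → v * x ∈ A
  ∈-scale⁻ {x = x} {y} {v} As xy≈1 (z , z∈A , lift v+zy≈0) =
    +-cancelʳ-∈ As (𝟎⊆ As (lift vx+z≈0)) z∈A
    where
    vx+z≈0 : v * x +ᴸ z ≈ 0#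
    vx+z≈0 = begin
      v * x +ᴸ z             ≈⟨ +-congˡ (trans (*-congˡ xy≈1) (*-identityʳ z)) ⟨
      v * x +ᴸ z * (x * y)   ≈⟨ solve 4 (λ v x z y → v :* x :+ z :* (x :* y) := (v :+ z :* y) :* x)
                                  refl v x z y ⟩
      (v +ᴸ z * y) * x       ≈⟨ *-congʳ v+zy≈0 ⟩
      0# * x                 ≈⟨ zeroˡ x ⟩
      0#                     ∎

  xy≈1⇒y≉0 : x * y ≈ 1# → ¬ (y ≈ 0#)
  xy≈1⇒y≉0 xy≈1 y≈0 = 1≉0 (trans (sym xy≈1) (trans (*-congˡ y≈0) (zeroʳ _)))

  -- The estimate after normalising to `1# ∈ A`. `M` and `T` stand for the rescaled `⟨ A · B ⟩` and
  -- `⟨ A · B · C ⟩`; the limit `A∞`, `B∞` supplies H and V, and y is `b * c`.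
  dim+dim≤dim : {A B : Pred Carrier P} {M : Pred Carrier s} {T : Pred Carrier t} {b c : Carrier} {N : ℕ} →
                IsSubspace A → IsSubspace B → IsSubspace M → IsSubspace T → 1# ∈ A →
                (∀ {x y} → x ∈ A → y ∈ B → x * y ∈ M) → M ⊆ T → (∀ {x} → x ∈ M → x * c ∈ T) →
                b ∈ B → b * c ∉ M →
                Codim 𝟎 A m → Codim 𝟎 B n → Codim 𝟎 T N → m + n ≤ N
  dim+dim≤dim {A = A} {B} {T = T} {b} {c} {N}
    As Bs Ms Ts 1∈A AB⊆M M⊆T Mc⊆T b∈B bc∉M dimA dimB dimT =
    ≡.subst (_≤ N) (≡.trans (ℕ.+-comm dimB∞ dimA∞) dim-sum)
      (codim-mono 𝟎-subspace B∞+A∞bc⊆T dim-B∞+A∞bc dimT)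
    where
    open DysonLimit (dysonLimit A B As Bs Ms 1∈A AB⊆M dimA dimB)

    -- Multiplication by a nonzero `h` in `A∞` preserves `B∞`, so `h * (b * c) ∈ B∞` would give
    -- `b * c ∈ B∞ ⊆ M`.
    A∞bc∩B∞⊆𝟎 : ∀ {h} → h ∈ A∞ → h * (b * c) ∈ B∞ → h ∈ 𝟎
    A∞bc∩B∞⊆𝟎 {h} h∈A∞ hbc∈B∞ with em {P = h ≈ 0#}
    ... | yes h≈0 = lift h≈0
    ... | no  h≉0 = ⊥-elim (bc∉M (B∞⊆M (divides-stable B∞-subspace B∞-codim h≉0
            (λ v∈B∞ → respects-≈ B∞-subspace (*-comm _ _) (A∞*B∞⊆B∞ h∈A∞ v∈B∞))
            (respects-≈ B∞-subspace (*-comm _ _) hbc∈B∞))))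

    dim-B∞+A∞bc : Codim 𝟎 (B∞ ⊞ A∞ ∙ (b * c)) (dimB∞ + dimA∞)
    dim-B∞+A∞bc = codim-trans dimB∞ B∞-subspace (𝟎⊆ B∞-subspace) (⊆⊞ B∞-subspace A∞-subspace) B∞-codim
      (codim-image B∞-subspace A∞-subspace (𝟎-*ʳ B∞-subspace) A∞bc∩B∞⊆𝟎 A∞-codim)

    -- As `b` lies in `B∞`, so does `h b`; hence `h b ∈ M`, and multiplication by `c` leads into
    -- `T`.
    B∞+A∞bc⊆T : B∞ ⊞ A∞ ∙ (b * c) ⊆ T
    B∞+A∞bc⊆T = ⊞-least {W = B∞} Ts (M⊆T ∘ B∞⊆M) λ h∈A∞ →
      respects-≈ Ts (*-assoc _ b c) (Mc⊆T (B∞⊆M (A∞*B∞⊆B∞ h∈A∞ (B⊆B∞ b∈B))))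

-- Finiteness of ⟨ABC⟩ and the lower bound for its dimension

module _ (em : ∀ {p} → ExcludedMiddle p) {c ℓ k a b d : Level}
         (L : Field c ℓ) (K : Pred (Field.Carrier L) k) (K-subfield : IsSubfield L K) where

  open Field L using (Carrier; _≈_; _*_; 0#; 1#; sym; trans; *-congˡ; *-congʳ; *-identityˡ;
                      *-identityʳ; *-assoc; *-comm; zeroˡ; inverse; 1≉0)
  open LinearAlgebra L K
  open IsSubspace
  open Flags em (a ⊔ b ⊔ d) L K K-subfield

  module _ {A : Pred Carrier a} {B : Pred Carrier b} {C : Pred Carrier d}
           (As : IsSubspace A) (Bs : IsSubspace B) (Cs : IsSubspace C) (K⊆C : K ⊆ C)
           {m n l : ℕ} (dimA : Codim 𝟎 A m) (dimB : Codim 𝟎 B n) (dimC : Codim 𝟎 C l) where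

    private
      AB  = ⟨ A · B ⟩
      ABC = ⟨ A · B · C ⟩

    ⟨AB⟩⊆⟨ABC⟩ : AB ⊆ ABC
    ⟨AB⟩⊆⟨ABC⟩ x∈AB =
      ⟨⟩-respects (A · B · C) (*-identityʳ _) (⟨⟩·⊆⟨·⟩ (A · B) C x∈AB (K⊆C 1∈K))

    -- `·-codim≤` is applied twice, to `A` and `B` and then to `⟨ A · B ⟩` and `C`.
    ⟨ABC⟩-codim : ∃[ N ] Codim 𝟎 ABC N
    ⟨ABC⟩-codim = codim≤⇒codim 𝟎-subspace N′
        (codim≤-resp N′ id (⟨⟩-least (A · B · C) (⟨⟩-subspace (AB · 𝟎+C)) λ (w , z , w∈A·B , z∈C , x≈wz) →
          ⊆⟨⟩ (AB · 𝟎+C) (w , z , ⊆⟨⟩ (A · B) w∈A·B , scale⁺ Cs z∈C , x≈wz)) dimAB·C)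
      where
      scale⁺ : ∀ {s x} {S : Pred Carrier s} → IsSubspace S → x ∈ S → x ∈ 𝟎 ⊞ S ∙ 1#
      scale⁺ Ss x∈S = ∈-scale⁺ Ss (*-identityʳ 1#) (respects-≈ Ss (sym (*-identityʳ _)) x∈S)

      -- Copies of B and C at level P.
      𝟎+B : Pred Carrier P
      𝟎+B = 𝟎 ⊞ B ∙ 1#
      𝟎+C : Pred Carrier P
      𝟎+C = 𝟎 ⊞ C ∙ 1#

      dimension : ∀ {s n} {S : Pred Carrier s} → IsSubspace S → Codim 𝟎 S n → Codim≤ 𝟎 (𝟎 ⊞ S ∙ 1#) n
      dimension {n = n} Ss dimS = codim⇒codim≤ n (codim-scale Ss 1≉0 dimS)

      Σ-dimA·B = ·-codim≤ {A = A} {B = 𝟎+B} m 𝟎-subspace (⊞-subspace 𝟎-subspace Bs)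
        (λ x∈𝟎 _ → 𝟎-*ʳ 𝟎-subspace x∈𝟎) (codim⇒codim≤ m dimA) (dimension Bs dimB)

      dimAB : Codim≤ 𝟎 AB (proj₁ Σ-dimA·B)
      dimAB = codim≤-resp (proj₁ Σ-dimA·B) id
        (⟨⟩-least (A · B) (⟨⟩-subspace (A · 𝟎+B)) λ (x , y , x∈A , y∈B , z≈xy) →
          ⊆⟨⟩ (A · 𝟎+B) (x , y , x∈A , scale⁺ Bs y∈B , z≈xy))
        (proj₂ Σ-dimA·B)

      Σ-dimAB·C = ·-codim≤ {A = AB} {B = 𝟎+C} (proj₁ Σ-dimA·B) 𝟎-subspace (⊞-subspace 𝟎-subspace Cs)
        (λ x∈𝟎 _ → 𝟎-*ʳ 𝟎-subspace x∈𝟎) dimAB (dimension Cs dimC)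
      N′ = proj₁ Σ-dimAB·C
      dimAB·C = proj₂ Σ-dimAB·C

    -- Write `x` as `u * v * z`. Here `u` is nonzero because `x` is, and scaling by its inverse
    -- brings 1 into `A` without changing dimensions.
    ABC⊈⟨AB⟩⇒dim≥ : ∀ {N x} → x ∈ A · B · C → x ∉ AB → Codim 𝟎 ABC N → m + n ≤ N
    ABC⊈⟨AB⟩⇒dim≥ {N} {x} (w , z , (u , v , u∈A , v∈B , w≈uv) , z∈C , x≈wz) x∉AB dimABC =
      dim+dim≤dim {A = A′} {B = B′} {M = M} {T = T} {b = v} {c = z}
        (scaled As) (scaled Bs) (scaled ABs) (scaled ABCs)
        (∈-scale⁺ As uu⁻¹≈1 (respects-≈ As (sym (*-identityˡ u)) u∈A))
        (λ x∈A′ y∈B′ → ∈-scale⁺ ABs uu⁻¹≈1 (⟨⟩-respects (A · B) (swap _ _ _)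
          (⊆⟨⟩ (A · B) (_ , _ , ∈-scale⁻ As uu⁻¹≈1 x∈A′ , ∈-scale⁻ Bs (*-identityʳ 1#) y∈B′ ,
            *-congˡ (sym (*-identityʳ _))))))
        (λ x∈M → ∈-scale⁺ ABCs uu⁻¹≈1 (⟨AB⟩⊆⟨ABC⟩ (∈-scale⁻ ABs uu⁻¹≈1 x∈M)))
        (λ x∈M → ∈-scale⁺ ABCs uu⁻¹≈1 (⟨⟩-respects (A · B · C) (swap _ _ _)
          (⟨⟩·⊆⟨·⟩ (A · B) C (∈-scale⁻ ABs uu⁻¹≈1 x∈M) z∈C)))
        (∈-scale⁺ Bs (*-identityʳ 1#) (respects-≈ Bs (sym (*-identityʳ v)) v∈B))
        -- Undoing the scaling turns `v * z ∈ M` into `v * z * u ∈ ⟨ A · B ⟩`, and that element is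
        -- `x`.
        (λ vz∈M → x∉AB (⟨⟩-respects (A · B) vzu≈x (∈-scale⁻ ABs uu⁻¹≈1 vz∈M)))
        (codim-scale As u⁻¹≉0 dimA) (codim-scale Bs 1≉0 dimB) (codim-scale ABCs u⁻¹≉0 dimABC)
      where
      ABs : IsSubspace AB
      ABs = ⟨⟩-subspace (A · B)
      ABCs : IsSubspace ABC
      ABCs = ⟨⟩-subspace (A · B · C)

      u≉0 : ¬ (u ≈ 0#)
      u≉0 u≈0 = x∉AB (⟨⟩-respects (A · B) (sym x≈0) (0∈⟨⟩ (A · B)))
        where
        x≈0 : x ≈ 0#
        x≈0 = trans x≈wz (trans (*-congʳ (trans w≈uv (trans (*-congʳ u≈0) (zeroˡ v)))) (zeroˡ z))

      u⁻¹ = proj₁ (inverse u u≉0)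
      uu⁻¹≈1 = proj₂ (inverse u u≉0)
      u⁻¹≉0 = xy≈1⇒y≉0 uu⁻¹≈1

      A′ B′ M T : Pred Carrier P
      A′ = 𝟎 ⊞ A ∙ u⁻¹
      -- Scaling by 1 only moves `B` to level `P`.
      B′ = 𝟎 ⊞ B ∙ 1#
      M  = 𝟎 ⊞ AB ∙ u⁻¹
      T  = 𝟎 ⊞ ABC ∙ u⁻¹

      scaled : ∀ {s e} {S : Pred Carrier s} → IsSubspace S → IsSubspace (𝟎 ⊞ S ∙ e)
      scaled = ⊞-subspace 𝟎-subspace

      swap : ∀ x y z → x * y * z ≈ x * z * y
      swap x y z = trans (*-assoc x y z) (trans (*-congˡ (*-comm y z)) (sym (*-assoc x z y)))

      vzu≈x : v * z * u ≈ x
      vzu≈x = trans (*-comm _ _) (trans (sym (*-assoc u v z))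
        (trans (*-congʳ (sym w≈uv)) (sym x≈wz)))

mainTheorem11 : (∀ {p} → ExcludedMiddle p) →
    ∀ {c ℓ k a b d : Level} (L : Field c ℓ) (K : Pred (Field.Carrier L) k) →
    let open Field L using (Carrier)
        open LinearAlgebra L K
        open Separability L K
    in
    IsSubfield L K →
    (∀ x → IsAlgebraic x → IsSeparable x) →
    (A : Pred Carrier a) (B : Pred Carrier b) (C : Pred Carrier d) →
    IsSubspace A → IsSubspace B → IsSubspace C →
    (finA : FiniteDimensional A) (finB : FiniteDimensional B) (finC : FiniteDimensional C) →
    ¬ (A ≐ ｛0｝) → ¬ (B ≐ ｛0｝) → K ⊆ C →
    (⟨ A · B · C ⟩ ≐ ⟨ A · B ⟩) ⊎
    (Σ[ finABC ∈ FiniteDimensional ⟨ A · B · C ⟩ ] dim finABC ≥ dim finA + dim finB)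
mainTheorem11 em {c} {ℓ} {k} {a} {b} {d} L K K-subfield _ A B C As Bs Cs finA finB finC _ _ K⊆C = result
  where
  open LinearAlgebra L K
  open Flags em (a ⊔ b ⊔ d) L K K-subfield

  dimA : Codim 𝟎 A (dim finA)
  dimA = finiteDimensional⇒codim As finA
  dimB : Codim 𝟎 B (dim finB)
  dimB = finiteDimensional⇒codim Bs finB
  dimC : Codim 𝟎 C (dim finC)
  dimC = finiteDimensional⇒codim Cs finC

  result : (⟨ A · B · C ⟩ ≐ ⟨ A · B ⟩) ⊎
           (Σ[ finABC ∈ FiniteDimensional ⟨ A · B · C ⟩ ] dim finABC ≥ dim finA + dim finB)
  -- The case split is on products rather than on their span, so that a failure is witnessed by a
  -- single product of three factors.
  result with em {P = (A · B · C) ⊆ ⟨ A · B ⟩}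
  ... | yes ABC⊆⟨AB⟩ = inj₁ (⟨⟩-least (A · B · C) (⟨⟩-subspace (A · B)) ABC⊆⟨AB⟩ ,
          ⟨AB⟩⊆⟨ABC⟩ em L K K-subfield As Bs Cs K⊆C dimA dimB dimC)
  ... | no  ABC⊈⟨AB⟩ with ⊈⇒∃ em ABC⊈⟨AB⟩ | ⟨ABC⟩-codim em L K K-subfield As Bs Cs K⊆C dimA dimB dimC
  ...   | x , x∈ABC , x∉⟨AB⟩ | N , dimABC with codim⇒finiteDimensional (⟨⟩-subspace (A · B · C)) dimABC
  ...     | finABC , ≡.refl = inj₂ (finABC ,
              ABC⊈⟨AB⟩⇒dim≥ em L K K-subfield As Bs Cs K⊆C dimA dimB dimC x∈ABC x∉⟨AB⟩ dimABC)
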